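{- Fix an integer $n\ge 1$ and let $\delta=2t+1$, where $t$ is a nonnegative integer with $t<n$. Suppose that \[ \delta-1+\left\lfloor\sqrt{\delta-1}\right\rfloor\left\lfloor\frac{\sqrt{4(\delta-1)+1}-1}{2}\right\rfloor>\frac{t(t+1)}{2}. \] Then perfect linear flag-rank-metric codes in $\mathrm{U}(n,\mathbb{F}_q)$ with minimum distance $\delta$ do not exist for all sufficiently large prime powers $q$; that is, there is $q_0=q_0(n,t)$ such that for every prime power $q\ge q_0$ there is no perfect linear flag-rank-metric code in $\mathrm{U}(n,\mathbb{F}_q)$ with minimum distance $\delta$.
   Context: $\mathbb{F}_q$ is the finite field with $q$ elements. $\mathrm{U}(n,\mathbb{F}_q)$ is the $\mathbb{F}_q$-vector space of $n\times n$ upper triangular matrices over $\mathbb{F}_q$. For $M\in \mathrm{U}(n,\mathbb{F}_q)$ and $1\le i\le n$, $M_{[i]}$ is the $i\times(n-i+1)$ submatrix of $M$ obtained by deleting the first $i-1$ columns and the last $n-i$ rows (i.e. rows $1,\dots,i$ and columns $i,\dots,n$). The flag-rank weight of $M$ is $\mathrm{fr}(M)=\sum_{i=1}^{n}\mathrm{rk}(M_{[i]})$; the flag-rank distance is $\mathrm{d}_{\mathrm{fr}}(A,B)=\mathrm{fr}(A-B)$. A linear flag-rank-metric code is an $\mathbb{F}_q$-subspace $\mathcal{C}$ of $\mathrm{U}(n,\mathbb{F}_q)$; its minimum (flag-rank) distance, defined when $\mathcal{C}\neq\{\boldsymbol{0}\}$, is $\delta=\min\{\mathrm{fr}(M):M\in\mathcal{C}\setminus\{\boldsymbol{0}\}\}$.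 Let $b_q(n,r)=|\{A\in \mathrm{U}(n,\mathbb{F}_q):\mathrm{fr}(A)\le r\}|$. A code $\mathcal{C}$ with minimum distance $\delta$ is perfect if $|\mathcal{C}|\,b_q\left(n,\left\lfloor\frac{\delta-1}{2}\right\rfloor\right)=q^{\frac{n(n+1)}{2}}$. -}

module Defs where

open import Level using (Level; _⊔_) renaming (suc to lsuc)
open import Algebra.Bundles using (CommutativeRing)
import Algebra.Properties.Semiring.Sum as SemiringSum
open import Data.Nat using (ℕ; zero; suc; _+_; _*_; _∸_; _^_; _≤_; _<_; z≤n; s≤s; _/_; _%_)
open import Data.Nat.Properties as ℕ using (_≤?_; +-*-semiring)
open import Data.Nat.DivMod using (m≡m%n+[m/n]*n; m%n<n)
open import Data.Nat.Primality using (Prime)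
open import Data.Nat.Tactic.RingSolver using (solve-∀)
open import Data.Fin using (Fin; zero; suc; toℕ; inject≤; cast; _↑ʳ_; finToFun; funToFin)
import Data.Fin as Fin
open import Data.Fin.Properties as Fin using (toℕ<n; all?; finToFun-funToFin; funToFin-finToFin; suc-injective)
open import Data.Fin.Subset using (Subset; ∣_∣; _∉_; ⊥)
open import Data.Fin.Subset.Properties using (_∈?_; anySubset?; ∣⊥∣≡0; ∉⊥; ∣p∣≤n)
open import Data.Product using (∃; ∃-syntax; _×_; _,_; proj₁; proj₂)
open import Function using (_∘_; Inverse)
open import Relation.Binary using (Setoid; Decidable)
import Relation.Binary.Construct.On as On
open import Relation.Binary.PropositionalEquality as ≡ using (_≡_; refl)
open import Relation.Nullary using (¬_; Dec; yes; no; contradiction; ¬?)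
open import Relation.Nullary.Decidable using (map′; _×-dec_; _→-dec_)
open import Relation.Unary using (Pred)

private
  variable
    a p : Level

private
  √-step : ℕ → ℕ → ℕ
  √-step x r with suc r * suc r ≤? x
  ... | yes _ = suc r
  ... | no  _ = r

⌊√_⌋ : ℕ → ℕ
⌊√ zero ⌋ = 0
⌊√ suc x ⌋ = √-step (suc x) ⌊√ x ⌋

⌊√⌋-spec : ∀ x → ⌊√ x ⌋ * ⌊√ x ⌋ ≤ x × x < suc ⌊√ x ⌋ * suc ⌊√ x ⌋
⌊√⌋-spec zero = z≤n , s≤s z≤n
⌊√⌋-spec (suc x) with ⌊√ x ⌋ | ⌊√⌋-spec x
... | r | lo , hi with suc r * suc r ≤? suc x
...   | yes h = h , ℕ.<-≤-trans (s≤s hi) (ℕ.*-mono-< {suc r} (ℕ.n<1+n _) (ℕ.n<1+n (suc r)))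
...   | no  h = ℕ.m≤n⇒m≤1+n lo , ℕ.≰⇒> h

-- ⌊(√x - 1)/2⌋, using that ⌊(y - 1)/2⌋ = ⌊(⌊y⌋ - 1)/2⌋ for real y ≥ 1.
⌊[√_-1]/2⌋ : ℕ → ℕ
⌊[√ x -1]/2⌋ = (⌊√ x ⌋ ∸ 1) / 2

-- k = ⌊(√x - 1)/2⌋ means 2k + 1 ≤ √x < 2(k + 1) + 1.
⌊[√-1]/2⌋-spec : ∀ x → 1 ≤ x → let k = ⌊[√ x -1]/2⌋ in
  (2 * k + 1) * (2 * k + 1) ≤ x × x < (2 * suc k + 1) * (2 * suc k + 1)
⌊[√-1]/2⌋-spec x 1≤x with ⌊√ x ⌋ | ⌊√⌋-spec x
... | zero  | lo , hi = contradiction 1≤x (ℕ.<⇒≱ hi)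
... | suc s | lo , hi =
    ℕ.≤-trans (ℕ.*-mono-≤ below below) lo
  , ℕ.<-≤-trans hi (ℕ.*-mono-≤ above above)
  where
  k = s / 2
  s≡ : s ≡ s % 2 + k * 2
  s≡ = m≡m%n+[m/n]*n s 2
  shift : ∀ m → 2 * m + 1 ≡ suc (m * 2)
  shift = solve-∀
  shift′ : ∀ m → 2 * suc m + 1 ≡ suc (2 + m * 2)
  shift′ = solve-∀
  below : 2 * k + 1 ≤ suc s
  below = ℕ.≤-trans (ℕ.≤-reflexive (shift k))
            (s≤s (ℕ.≤-trans (ℕ.m≤n+m (k * 2) (s % 2)) (ℕ.≤-reflexive (≡.sym s≡))))
  above : suc (suc s) ≤ 2 * suc k + 1
  above = ℕ.≤-trans
            (s≤s (ℕ.≤-trans (ℕ.≤-reflexive (≡.cong suc s≡)) (ℕ.+-monoˡ-≤ (k * 2) (m%n<n s 2))))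
            (ℕ.≤-reflexive (≡.sym (shift′ k)))

HasSize : ∀ {ℓ} → Setoid a ℓ → ℕ → Set (a ⊔ ℓ)
HasSize S k = Inverse S (≡.setoid (Fin k))

Subsetoid : ∀ {ℓ} (S : Setoid a ℓ) → Pred (Setoid.Carrier S) p → Setoid (a ⊔ p) ℓ
Subsetoid S P = On.setoid {B = ∃ P} S proj₁

private
  record Enumeration {m} (P : Pred (Fin m) p) : Set p where
    field
      size  : ℕ
      elem  : Fin size → Fin m
      holds : ∀ i → P (elem i)
      inj   : ∀ {i j} → elem i ≡ elem j → i ≡ j
      index : ∀ {x} → P x → Fin size
      elem-index : ∀ {x} (px : P x) → elem (index px) ≡ x

  enumerate : ∀ {m} {P : Pred (Fin m) p} → (∀ x → Dec (P x)) → Enumeration P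
  enumerate {m = zero} P? = record
    { size = 0 ; elem = λ () ; holds = λ () ; inj = λ { {()} }
    ; index = λ { {()} } ; elem-index = λ { {()} } }
  enumerate {m = suc m} {P} P? with P? zero | enumerate (P? ∘ suc)
  ... | no ¬p0 | E = record
    { size = E.size
    ; elem = suc ∘ E.elem
    ; holds = E.holds
    ; inj = E.inj ∘ suc-injective
    ; index = λ { {zero} p0 → contradiction p0 ¬p0 ; {suc x} → E.index }
    ; elem-index = λ { {zero} p0 → contradiction p0 ¬p0
                     ; {suc x} px → ≡.cong suc (E.elem-index px) } }
    where module E = Enumeration E
  ... | yes p0 | E = record
    { size = suc E.size
    ; elem = λ { zero → zero ; (suc i) → suc (E.elem i) }
    ; holds = λ { zero → p0 ; (suc i) → E.holds i }
    ; inj = λ { {zero} {zero} _ → refl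
              ; {suc i} {suc j} eq → ≡.cong suc (E.inj (suc-injective eq)) }
    ; index = λ { {zero} _ → zero ; {suc x} px → suc (E.index px) }
    ; elem-index = λ { {zero} _ → refl ; {suc x} px → ≡.cong suc (E.elem-index px) } }
    where module E = Enumeration E

subsetoid-finite : ∀ {ℓ m} {S : Setoid a ℓ} {P : Pred (Setoid.Carrier S) p} →
                   HasSize S m →
                   (∀ {x y} → Setoid._≈_ S x y → P x → P y) →
                   (∀ x → Dec (P x)) →
                   ∃[ k ] HasSize (Subsetoid S P) k
subsetoid-finite {m = m} {S = S} {P} bij resp P? = E.size , record
  { to = λ (x , px) → E.index (code x px)
  ; from = λ i → I.from (E.elem i) , E.holds i
  ; to-cong = λ {(x , px)} {(y , py)} x≈y → E.inj
      (≡.trans (E.elem-index (code x px))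
        (≡.trans (I.to-cong x≈y) (≡.sym (E.elem-index (code y py)))))
  ; from-cong = λ { refl → S.refl }
  ; inverse =
      (λ {i} {(x , px)} x≈ → E.inj
         (≡.trans (E.elem-index (code x px)) (I.inverseˡ x≈)))
    , (λ {(x , px)} {i} eq →
         I.inverseʳ (≡.trans (≡.cong E.elem eq) (E.elem-index (code x px))))
  }
  where
  module S = Setoid S
  module I = Inverse bij
  module E = Enumeration (enumerate {P = P ∘ I.from} (P? ∘ I.from))
  code : ∀ x → P x → P (I.from (I.to x))
  code x = resp (S.sym (I.inverseʳ refl))

PointwiseSetoid : ∀ {ℓ} → Setoid a ℓ → ℕ → Setoid a ℓ
PointwiseSetoid S n = record
  { Carrier = Fin n → S.Carrier
  ; _≈_ = λ f g → ∀ i → f i S.≈ g i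
  ; isEquivalence = record
    { refl = λ _ → S.refl
    ; sym = λ f≈g i → S.sym (f≈g i)
    ; trans = λ f≈g g≈h i → S.trans (f≈g i) (g≈h i) } }
  where module S = Setoid S

private
  funToFin-cong : ∀ {m k} {f g : Fin k → Fin m} → (∀ i → f i ≡ g i) → funToFin f ≡ funToFin g
  funToFin-cong {k = zero}  f≗g = refl
  funToFin-cong {k = suc k} f≗g = ≡.cong₂ Fin.combine (f≗g zero) (funToFin-cong (f≗g ∘ suc))

pointwise-size : ∀ {ℓ m} {S : Setoid a ℓ} → HasSize S m → ∀ n → HasSize (PointwiseSetoid S n) (m ^ n)
pointwise-size {m = m} {S} bij n = record
  { to = λ f → funToFin (I.to ∘ f)
  ; from = λ k i → I.from (finToFun k i)
  ; to-cong = λ f≈g → funToFin-cong (I.to-cong ∘ f≈g)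
  ; from-cong = λ { refl i → Setoid.refl S }
  ; inverse =
      (λ {k} f≈ → ≡.trans (funToFin-cong (I.inverseˡ ∘ f≈)) (funToFin-finToFin {n} {m} k))
    , (λ {f} {k} eq i → I.inverseʳ
         (≡.trans (≡.cong (λ k′ → finToFun {m} {n} k′ i) eq) (finToFun-funToFin (I.to ∘ f) i)))
  }
  where module I = Inverse bij

∀-finite? : ∀ {ℓ m} {S : Setoid a ℓ} {P : Pred (Setoid.Carrier S) p} →
            HasSize S m →
            (∀ {x y} → Setoid._≈_ S x y → P x → P y) →
            (∀ x → Dec (P x)) →
            Dec (∀ x → P x)
∀-finite? bij resp P? =
  map′ (λ h x → resp (I.inverseʳ refl) (h (I.to x))) (λ h i → h (I.from i)) (all? (P? ∘ I.from))
  where module I = Inverse bij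

IsPrimePower : ℕ → Set
IsPrimePower q = ∃[ p ] ∃[ k ] (Prime p × 1 ≤ k × q ≡ p ^ k)

record FiniteField c ℓ (q : ℕ) : Set (lsuc (c ⊔ ℓ)) where
  field
    commutativeRing : CommutativeRing c ℓ
  open CommutativeRing commutativeRing using (_≈_; 0#; 1#; setoid) renaming (_*_ to _·_)
  field
    0≉1     : ¬ 0# ≈ 1#
    inverse : ∀ x → ¬ x ≈ 0# → ∃[ y ] x · y ≈ 1#
    hasSize : HasSize setoid q

module FlagRank {c ℓ q} (F : FiniteField c ℓ q) where

  open FiniteField F using (commutativeRing; hasSize) public
  open CommutativeRing commutativeRing public
    using (Carrier; _≈_; 0#; 1#; setoid; semiring)
    renaming (_+_ to _+ꟳ_; _*_ to _*ꟳ_; -_ to -ꟳ_)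
  private module R = CommutativeRing commutativeRing
  open SemiringSum semiring public using () renaming (sum to sumꟳ)
  open SemiringSum +-*-semiring public using () renaming (sum to sumℕ)

  _≈?_ : Decidable _≈_
  x ≈? y = map′ (λ eq → R.trans (R.sym (I.inverseʳ refl)) (I.inverseʳ eq)) I.to-cong
                (I.to x Fin.≟ I.to y)
    where module I = Inverse hasSize

  Matrix : ℕ → ℕ → Set c
  Matrix m k = Fin m → Fin k → Carrier

  matrixSetoid : ℕ → ℕ → Setoid c ℓ
  matrixSetoid m k = PointwiseSetoid (PointwiseSetoid setoid k) m

  infix 4 _≈ᴹ_
  _≈ᴹ_ : ∀ {m k} → Matrix m k → Matrix m k → Set ℓ
  _≈ᴹ_ {m} {k} = Setoid._≈_ (matrixSetoid m k)

  0ᴹ : ∀ {m k} → Matrix m k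
  0ᴹ _ _ = 0#

  _+ᴹ_ : ∀ {m k} → Matrix m k → Matrix m k → Matrix m k
  (A +ᴹ B) i j = A i j +ꟳ B i j

  _∙ᴹ_ : ∀ {m k} → Carrier → Matrix m k → Matrix m k
  (x ∙ᴹ A) i j = x *ꟳ A i j

  -- Coefficient vectors supported on S encode linear combinations of the
  -- columns of A indexed by S.
  IndependentColumns : ∀ {m k} → Matrix m k → Subset k → Set (c ⊔ ℓ)
  IndependentColumns {m} {k} A S =
    ∀ (x : Fin k → Carrier) → (∀ j → j ∉ S → x j ≈ 0#) →
    (∀ i → sumꟳ (λ j → x j *ꟳ A i j) ≈ 0#) → ∀ j → x j ≈ 0#

  IsRank : ∀ {m k} → Matrix m k → ℕ → Set (c ⊔ ℓ)
  IsRank {k = k} A r =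
      (∃[ S ] (∣ S ∣ ≡ r × IndependentColumns A S))
    × (∀ S → IndependentColumns A S → ∣ S ∣ ≤ r)

  private
    open SemiringSum semiring using (sum-cong-≋)

    independent? : ∀ {m k} (A : Matrix m k) S → Dec (IndependentColumns A S)
    independent? {k = k} A S = ∀-finite? (pointwise-size hasSize k)
      (λ {x} {y} x≈y h s z j → R.trans (R.sym (x≈y j))
         (h (λ j j∉ → R.trans (x≈y j) (s j j∉))
            (λ i → R.trans (sum-cong-≋ (λ j → R.*-congʳ (x≈y j))) (z i)) j))
      (λ x → all? (λ j → ¬? (j ∈? S) →-dec (x j ≈? 0#))
        →-dec (all? (λ i → sumꟳ (λ j → x j *ꟳ A i j) ≈? 0#)
        →-dec all? (λ j → x j ≈? 0#)))

    independent-resp : ∀ {m k} {A B : Matrix m k} {S} → A ≈ᴹ B →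
                       IndependentColumns A S → IndependentColumns B S
    independent-resp A≈B h x s z = h x s
      (λ i → R.trans (sum-cong-≋ (λ j → R.*-congˡ (A≈B i j))) (z i))

    findRank : ∀ {m k} (A : Matrix m k) b → (∀ S → IndependentColumns A S → ∣ S ∣ ≤ b) → ∃ (IsRank A)
    findRank {k = k} A zero bound =
      0 , (⊥ , ∣⊥∣≡0 k , λ x s z j → s j ∉⊥) , bound
    findRank A (suc b) bound
      with anySubset? (λ S → (∣ S ∣ ℕ.≟ suc b) ×-dec independent? A S)
    ... | yes found = suc b , found , bound
    ... | no none = findRank A b λ S ind →
      ℕ.≤-pred (ℕ.≤∧≢⇒< (bound S ind) (λ eq → none (S , eq , ind)))

  rank-exists : ∀ {m k} (A : Matrix m k) → ∃ (IsRank A)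
  rank-exists {k = k} A = findRank A k (λ S _ → ∣p∣≤n S)

  rank : ∀ {m k} → Matrix m k → ℕ
  rank A = proj₁ (rank-exists A)

  rank-spec : ∀ {m k} (A : Matrix m k) → IsRank A (rank A)
  rank-spec A = proj₂ (rank-exists A)

  rank-cong : ∀ {m k} {A B : Matrix m k} → A ≈ᴹ B → rank A ≡ rank B
  rank-cong A≈B = ℕ.≤-antisym (mono A≈B) (mono λ i j → R.sym (A≈B i j))
    where
    mono : ∀ {m k} {A B : Matrix m k} → A ≈ᴹ B → rank A ≤ rank B
    mono {A = A} {B} A≈B with rank-spec A | rank-spec B
    ... | (S , eq , ind) , _ | _ , bound =
      ≡.subst (_≤ rank B) eq (bound S (independent-resp A≈B ind))

  -- With 0-based index i, rows 0..i and columns i..n-1.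
  infix 30 _[_]
  _[_] : ∀ {n} → Matrix n n → (i : Fin n) → Matrix (suc (toℕ i)) (n ∸ toℕ i)
  _[_] {n} M i r s =
    M (inject≤ r (toℕ<n i)) (cast (ℕ.m+[n∸m]≡n (ℕ.<⇒≤ (toℕ<n i))) (toℕ i ↑ʳ s))

  fr : ∀ {n} → Matrix n n → ℕ
  fr {n} M = sumℕ (λ (i : Fin n) → rank (M [ i ]))

  fr-cong : ∀ {n} {A B : Matrix n n} → A ≈ᴹ B → fr A ≡ fr B
  fr-cong {n} {A} {B} A≈B = SemiringSum.sum-cong-≋ +-*-semiring {n}
    {λ i → rank (A [ i ])} {λ i → rank (B [ i ])}
    (λ i → rank-cong {A = A [ i ]} {B [ i ]} (λ r s → A≈B _ _))

  IsUpperTriangular : ∀ {n} → Pred (Matrix n n) ℓ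
  IsUpperTriangular M = ∀ i j → toℕ j < toℕ i → M i j ≈ 0#

  Ball : ∀ n → ℕ → Pred (Matrix n n) ℓ
  Ball n r A = IsUpperTriangular A × fr A ≤ r

  ball-finite : ∀ n r → ∃[ k ] HasSize (Subsetoid (matrixSetoid n n) (Ball n r)) k
  ball-finite n r = subsetoid-finite (pointwise-size (pointwise-size hasSize n) n)
    (λ A≈B (up , le) →
        (λ i j j<i → R.trans (R.sym (A≈B i j)) (up i j j<i))
      , ≡.subst (_≤ r) (fr-cong A≈B) le)
    (λ A → all? (λ i → all? (λ j → (toℕ j ℕ.<? toℕ i) →-dec (A i j ≈? 0#))) ×-dec (fr A ≤? r))

  ballSize : ℕ → ℕ → ℕ
  ballSize n r = proj₁ (ball-finite n r)

  record LinearCode (n : ℕ) p : Set (c ⊔ ℓ ⊔ lsuc p) where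
    field
      member     : Pred (Matrix n n) p
      upper      : ∀ {A} → member A → IsUpperTriangular A
      resp       : ∀ {A B} → A ≈ᴹ B → member A → member B
      0-closed   : member 0ᴹ
      +-closed   : ∀ {A B} → member A → member B → member (A +ᴹ B)
      ∙-closed   : ∀ x {A} → member A → member (x ∙ᴹ A)

  codeSetoid : ∀ {n} → LinearCode n p → Setoid (c ⊔ p) ℓ
  codeSetoid {n = n} C = Subsetoid (matrixSetoid n n) (LinearCode.member C)

  HasMinimumDistance : ∀ {n} → LinearCode n p → ℕ → Set (c ⊔ ℓ ⊔ p)
  HasMinimumDistance C δ =
      (∃[ M ] (member M × ¬ M ≈ᴹ 0ᴹ × fr M ≡ δ))
    × (∀ M → member M → ¬ M ≈ᴹ 0ᴹ → δ ≤ fr M)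
    where open LinearCode C

  IsPerfectWithMinimumDistance : ∀ {n} → LinearCode n p → ℕ → Set (c ⊔ ℓ ⊔ p)
  IsPerfectWithMinimumDistance {n = n} C δ =
      HasMinimumDistance C δ
    × (∃[ N ] (HasSize (codeSetoid C) N × N * ballSize n ((δ ∸ 1) / 2) ≡ q ^ (n * (n + 1) / 2)))

{-# OPTIONS --safe #-}
-- A linear anticode all of whose elements have flag-rank at most 2t meets a code
-- of minimum distance 2t + 1 only in zero.  The hypothesis on t forces 1 ≤ t ≤ 5,
-- and then the matrices supported on the upper triangle of the leading t × t block
-- and on the diagonal entry (t, t) form such an anticode of dimension T + 1, where
-- T = t (t + 1) / 2.  Hence |C| q^(T + 1) ≤ q^(n (n + 1) / 2).  On the other hand,
-- if fr M ≤ t then M[i] ≠ 0 for at most t indices i, and the nonzero entries of M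
-- have both coordinates among these, so the ball of radius t has at most n^t q^T
-- elements.  For a perfect code the two bounds give q ≤ n^t.
module Submission where

open import Defs
open import Level using (Level)
open import Algebra.Bundles using (CommutativeRing)
import Algebra.Properties.Ring as RingProperties
import Algebra.Properties.Semiring.Sum as SemiringSum
open import Data.Bool using (true; false; if_then_else_)
open import Data.Nat using (ℕ; zero; suc; _+_; _*_; _∸_; _^_; _⊓_; _≤_; _<_; _>_; _/_; _≡ᵇ_; z≤n; s≤s; NonZero; >-nonZero)
open import Data.Nat.Properties as ℕ using (+-*-semiring)
open import Data.Nat.DivMod using (m*n/n≡m)
open import Data.Nat.Tactic.RingSolver using (solve-∀)
open import Data.Fin using (Fin; zero; suc; toℕ; fromℕ<; inject≤; cast; join; splitAt; _↑ˡ_; _↑ʳ_)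
import Data.Fin as Fin
open import Data.Fin.Properties as Fin using (any?; *↔×; injective⇒≤; join-splitAt; toℕ-injective)
open import Data.Fin.Subset using (Subset; ∣_∣; _∈_; _∉_; ⁅_⁆)
open import Data.Fin.Subset.Properties using (∣⁅x⁆∣≡1; x≢y⇒x∉⁅y⁆)
open import Data.Empty using (⊥)
open import Data.Product using (∃; ∃-syntax; _×_; _,_; proj₁; proj₂)
import Data.Product.Properties as Product
open import Data.Product.Function.NonDependent.Setoid using (_×-inverse_)
open import Data.Product.Relation.Binary.Pointwise.NonDependent using (_×ₛ_; Pointwise-≡↔≡)
open import Data.Sum using (_⊎_; inj₁; inj₂)
open import Data.Vec using ([]; _∷_; here; there)
open import Function using (_∘_; Inverse)
import Function.Construct.Composition as Composition
import Function.Construct.Identity as Identity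
import Function.Construct.Symmetry as Symmetry
open import Relation.Binary using (Setoid; tri<; tri≈; tri>)
open import Relation.Binary.PropositionalEquality as ≡ using (_≡_; _≢_; refl)
open import Relation.Nullary using (¬_; yes; no; contradiction)
open import Relation.Nullary.Decidable using (decidable-stable)

-- Cardinalities of finite setoids.

×-size : ∀ {a ℓ b ℓ′ m k} {S : Setoid a ℓ} {S′ : Setoid b ℓ′} →
         HasSize S m → HasSize S′ k → HasSize (S ×ₛ S′) (m * k)
×-size f g = Composition.inverse (f ×-inverse g)
               (Composition.inverse Pointwise-≡↔≡ (Symmetry.inverse *↔×))

-- Cardinalities do the work of dimensions: the bound of the rank by the number of rows, the bound
-- on the ball and the bound on code times anticode all come from injections.
injection-size : ∀ {a ℓ b ℓ′ m k} {S : Setoid a ℓ} {S′ : Setoid b ℓ′} →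
                 HasSize S m → HasSize S′ k →
                 (f : Setoid.Carrier S → Setoid.Carrier S′) →
                 (∀ x y → Setoid._≈_ S′ (f x) (f y) → Setoid._≈_ S x y) → m ≤ k
injection-size {S = S} {S′} sS sS′ f f-inj = injective⇒≤ {f = I′.to ∘ f ∘ I.from} λ {i} {j} eq →
  ≡.trans (≡.sym (I.inverseˡ (Setoid.refl S)))
    (I.inverseˡ (f-inj _ _
      (Setoid.trans S′ (Setoid.sym S′ (I′.inverseʳ refl)) (I′.inverseʳ eq))))
  where
  module I = Inverse sS
  module I′ = Inverse sS′

-- Triangular numbers and positions on or above the diagonal.

triangle : ℕ → ℕ
triangle zero    = 0
triangle (suc n) = suc n + triangle n

triangle*2 : ∀ n → triangle n * 2 ≡ n * (n + 1)
triangle*2 zero    = refl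
triangle*2 (suc n) = ≡.trans (step n (triangle n))
  (≡.trans (≡.cong (suc n * 2 +_) (triangle*2 n)) (step′ n))
  where
  step : ∀ n x → (suc n + x) * 2 ≡ suc n * 2 + x * 2
  step = solve-∀
  step′ : ∀ n → suc n * 2 + n * (n + 1) ≡ suc n * (suc n + 1)
  step′ = solve-∀

n[n+1]/2≡triangle : ∀ n → n * (n + 1) / 2 ≡ triangle n
n[n+1]/2≡triangle n = ≡.trans (≡.cong (_/ 2) (≡.sym (triangle*2 n))) (m*n/n≡m (triangle n) 2)

-- Row-by-row numbering of the positions with i ≤ j; the recursion of `triangle` adds the first row
-- to a smaller triangle. The next three lemmas show that it is a bijection.
upperPair : ∀ n → Fin (triangle n) → Fin n × Fin n
upperPair (suc n) k with splitAt (suc n) k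
... | inj₁ j  = zero , j
... | inj₂ k′ = let (i , j) = upperPair n k′ in suc i , suc j

upperPair-≤ : ∀ n k → toℕ (proj₁ (upperPair n k)) ≤ toℕ (proj₂ (upperPair n k))
upperPair-≤ (suc n) k with splitAt (suc n) k
... | inj₁ j  = z≤n
... | inj₂ k′ = s≤s (upperPair-≤ n k′)

upperPair-injective : ∀ n k k′ → upperPair n k ≡ upperPair n k′ → k ≡ k′
upperPair-injective (suc n) k k′ eq
  with splitAt (suc n) k in e | splitAt (suc n) k′ in e′
... | inj₁ j | inj₁ j′ = ≡.trans (≡.sym (join-splitAt (suc n) (triangle n) k))
  (≡.trans (≡.cong (join (suc n) (triangle n)) (≡.trans e (≡.trans (≡.cong inj₁ (≡.cong proj₂ eq)) (≡.sym e′))))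
    (join-splitAt (suc n) (triangle n) k′))
... | inj₁ _ | inj₂ _ = contradiction (≡.cong proj₁ eq) λ ()
... | inj₂ _ | inj₁ _ = contradiction (≡.cong proj₁ eq) λ ()
... | inj₂ l | inj₂ l′ = ≡.trans (≡.sym (join-splitAt (suc n) (triangle n) k))
  (≡.trans (≡.cong (join (suc n) (triangle n)) (≡.trans e (≡.trans (≡.cong inj₂ (upperPair-injective n l l′ eq′)) (≡.sym e′))))
    (join-splitAt (suc n) (triangle n) k′))
  where
  eq′ : upperPair n l ≡ upperPair n l′
  eq′ = ≡.cong₂ _,_ (Fin.suc-injective (≡.cong proj₁ eq)) (Fin.suc-injective (≡.cong proj₂ eq))

upperPair-surjective : ∀ n i j → toℕ i ≤ toℕ j → ∃[ k ] upperPair n k ≡ (i , j)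
upperPair-surjective (suc n) zero j _ = j ↑ˡ triangle n , lemma
  where
  lemma : upperPair (suc n) (j ↑ˡ triangle n) ≡ (zero , j)
  lemma rewrite Fin.splitAt-↑ˡ (suc n) j (triangle n) = refl
upperPair-surjective (suc n) (suc i) (suc j) (s≤s i≤j) with upperPair-surjective n i j i≤j
... | k , eq = suc n ↑ʳ k , lemma
  where
  lemma : upperPair (suc n) (suc n ↑ʳ k) ≡ (suc i , suc j)
  lemma rewrite Fin.splitAt-↑ʳ (suc n) (triangle n) k | eq = refl

-- A tuple `e` of indices need not be increasing, so (`e a`, `e b`) with a ≤ b may lie below the
-- diagonal; sorting reflects it back.
sort : ∀ {n} → Fin n → Fin n → Fin n × Fin n
sort i j with i Fin.≤? j
... | yes _ = i , j
... | no  _ = j , i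

sort-≤ : ∀ {n} (i j : Fin n) → toℕ i ≤ toℕ j → sort i j ≡ (i , j)
sort-≤ i j i≤j with i Fin.≤? j
... | yes _   = refl
... | no i≰j = contradiction i≤j i≰j

sort-≥ : ∀ {n} (i j : Fin n) → toℕ j ≤ toℕ i → sort i j ≡ (j , i)
sort-≥ i j j≤i with i Fin.≤? j
... | no _    = refl
... | yes i≤j with toℕ-injective (ℕ.≤-antisym i≤j j≤i)
...   | refl = refl

-- If b < a, the pair numbered (b, a) is sorted back to (`e a`, `e b`). Hence `triangle t` values
-- record every entry on or above the diagonal with both coordinates in the image of `e`.
sort-surjective : ∀ {n t} (e : Fin t → Fin n) a b → toℕ (e a) ≤ toℕ (e b) →
                  ∃[ k ] (let (a′ , b′) = upperPair t k in sort (e a′) (e b′)) ≡ (e a , e b)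
sort-surjective {t = t} e a b ea≤eb with ℕ.≤-total (toℕ a) (toℕ b)
... | inj₁ a≤b with upperPair-surjective t a b a≤b
...   | k , eq = k , ≡.trans (≡.cong (λ (a′ , b′) → sort (e a′) (e b′)) eq) (sort-≤ (e a) (e b) ea≤eb)
sort-surjective {t = t} e a b ea≤eb | inj₂ b≤a with upperPair-surjective t b a b≤a
...   | k , eq = k , ≡.trans (≡.cong (λ (a′ , b′) → sort (e a′) (e b′)) eq) (sort-≥ (e b) (e a) ea≤eb)

-- Sums of natural numbers and their supports.

open SemiringSum +-*-semiring using () renaming (sum to sumℕ; sum-replicate-zero to sumℕ-zero)

sumℕ-mono-≤ : ∀ {n} {f g : Fin n → ℕ} → (∀ i → f i ≤ g i) → sumℕ f ≤ sumℕ g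
sumℕ-mono-≤ {zero}  f≤g = z≤n
sumℕ-mono-≤ {suc n} f≤g = ℕ.+-mono-≤ (f≤g zero) (sumℕ-mono-≤ (f≤g ∘ suc))

-- x₀ fills the slots of e that the support of g does not need.
cover-support : ∀ {a} {X : Set a} (x₀ : X) {n} t (ι : Fin n → X) (g : Fin n → ℕ) → sumℕ g ≤ t →
                ∃ λ (e : Fin t → X) → ∀ i → g i ≡ 0 ⊎ ∃[ s ] e s ≡ ι i
cover-support {X = X} x₀ {zero}  t ι g _ = (λ (_ : Fin t) → x₀) , λ ()
cover-support {X = X} x₀ {suc n} t ι g Σg≤t with g zero in g0 | Σg≤t
... | zero  | le with cover-support x₀ t (ι ∘ suc) (g ∘ suc) le
...   | e , cover = e , λ { zero → inj₁ g0 ; (suc i) → cover i }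
cover-support {X = X} x₀ {suc n} (suc t) ι g _ | suc m | s≤s le
  -- The positive value of `g zero` pays for one slot, and the remaining values still sum to at most
  -- `t`.
  with cover-support x₀ t (ι ∘ suc) (g ∘ suc) (ℕ.≤-trans (ℕ.m≤n+m _ m) le)
...   | e , cover = e′ , cover′
  where
  e′ : Fin (suc t) → X
  e′ zero    = ι zero
  e′ (suc s) = e s
  cover′ : ∀ i → g i ≡ 0 ⊎ ∃[ s ] e′ s ≡ ι i
  cover′ zero = inj₂ (zero , refl)
  cover′ (suc i) with cover i
  ... | inj₁ gi≡0     = inj₁ gi≡0
  ... | inj₂ (s , eq) = inj₂ (suc s , eq)

-- Arithmetic of the condition on t and of the anticode weight.

-- Let a and b be the two factors. Then a² ≤ r, and (2b + 1)² ≤ 4r + 1 gives b² ≤ r, so the product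
-- is at most the square of the larger factor, hence at most r.
⌊√⌋*⌊[√-1]/2⌋≤ : ∀ r → ⌊√ r ⌋ * ⌊[√ (4 * r + 1) -1]/2⌋ ≤ r
⌊√⌋*⌊[√-1]/2⌋≤ r with ⌊√ r ⌋ | ⌊√⌋-spec r | ⌊[√ (4 * r + 1) -1]/2⌋ | ⌊[√-1]/2⌋-spec (4 * r + 1) (ℕ.m≤n+m 1 (4 * r))
... | a | a²≤r , _ | b | [2b+1]²≤4r+1 , _ with ℕ.≤-total a b
...   | inj₂ b≤a = ℕ.≤-trans (ℕ.*-monoʳ-≤ a b≤a) a²≤r
...   | inj₁ a≤b = ℕ.≤-trans (ℕ.*-monoˡ-≤ b a≤b) (ℕ.*-cancelˡ-≤ 4 (ℕ.+-cancelʳ-≤ 1 _ _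
  (ℕ.≤-trans (ℕ.≤-trans (ℕ.m≤m+n _ (4 * b)) (ℕ.≤-reflexive (expand b))) [2b+1]²≤4r+1)))
  where
  expand : ∀ b → 4 * (b * b) + 1 + 4 * b ≡ (2 * b + 1) * (2 * b + 1)
  expand = solve-∀

-- The left side is at most 2r = 4t, while t (t + 1) / 2 ≥ 4t as soon as t ≥ 7. Only t = 6 needs an
-- exact evaluation.
condition⇒t≤5 : ∀ t → let r = 2 * t in
      r + ⌊√ r ⌋ * ⌊[√ (4 * r + 1) -1]/2⌋ > triangle t → t ≤ 5
condition⇒t≤5 t h with ℕ.<-cmp t 6
... | tri< t<6 _ _  = ℕ.≤-pred t<6
-- At t = 6 both sides of the condition are 21.
... | tri≈ _ refl _ = contradiction h (ℕ.≤⇒≯ ℕ.≤-refl)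
... | tri> _ _ 6<t  = contradiction h (ℕ.≤⇒≯
  (ℕ.≤-trans (ℕ.+-monoʳ-≤ (2 * t) (⌊√⌋*⌊[√-1]/2⌋≤ (2 * t))) (ℕ.*-cancelʳ-≤ _ _ 2 4t*2≤)))
  where
  eight : ∀ t → (2 * t + 2 * t) * 2 ≡ t * 8
  eight = solve-∀
  4t*2≤ : (2 * t + 2 * t) * 2 ≤ triangle t * 2
  4t*2≤ = begin
    (2 * t + 2 * t) * 2 ≡⟨ eight t ⟩
    t * 8               ≤⟨ ℕ.*-monoʳ-≤ t (ℕ.+-monoˡ-≤ 1 6<t) ⟩
    t * (t + 1)         ≡⟨ triangle*2 t ⟨
    triangle t * 2      ∎
    where open ℕ.≤-Reasoning

-- Bounds the number of nonzero columns of M[i] for M in the anticode.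
anticodeWidth : ℕ → ℕ → ℕ
anticodeWidth t i = t ∸ i + (if i ≡ᵇ t then 1 else 0)

anticodeWidth-diagonal : ∀ t → 0 < anticodeWidth t t
anticodeWidth-diagonal zero    = s≤s z≤n
anticodeWidth-diagonal (suc t) = anticodeWidth-diagonal t

-- The terms after index t vanish, which leaves the sums 2, 3, 5, 7, 10 for t = 1, ..., 5. For t = 6
-- the sum would be 13, more than 12.
anticode-weight : ∀ t m → 1 ≤ t → t ≤ 5 →
                  sumℕ {suc t + m} (λ i → suc (toℕ i) ⊓ anticodeWidth t (toℕ i)) ≤ 2 * t
anticode-weight 1 m _ _ = ℕ.≤-reflexive (≡.cong (2 +_) (sumℕ-zero m))
anticode-weight 2 m _ _ = ℕ.≤-trans (ℕ.≤-reflexive (≡.cong (3 +_) (sumℕ-zero m))) (ℕ.n≤1+n 3)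
anticode-weight 3 m _ _ = ℕ.≤-trans (ℕ.≤-reflexive (≡.cong (5 +_) (sumℕ-zero m))) (ℕ.n≤1+n 5)
anticode-weight 4 m _ _ = ℕ.≤-trans (ℕ.≤-reflexive (≡.cong (7 +_) (sumℕ-zero m))) (ℕ.n≤1+n 7)
anticode-weight 5 m _ _ = ℕ.≤-reflexive (≡.cong (10 +_) (sumℕ-zero m))
anticode-weight (suc (suc (suc (suc (suc (suc _)))))) _ _ (s≤s (s≤s (s≤s (s≤s (s≤s ())))))

module _ {c ℓ q} (F : FiniteField c ℓ q) where

  open FlagRank F hiding (sumℕ)
  private
    module F = FiniteField F
    module R = CommutativeRing commutativeRing

  -- Differences and finite sums in the field.

  open RingProperties R.ring using (-1*x≈-x; x∙y⁻¹≈ε⇒x≈y; x≈y⇒x∙y⁻¹≈ε; +-cancelˡ)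
  open SemiringSum semiring using (sum-cong-≋; sum-replicate-zero; ∑-distrib-+; *-distribˡ-sum)
  open import Relation.Binary.Reasoning.Setoid setoid

  -- Subtraction in the form available from +-closed and ∙-closed.
  infixl 6 _⊖_
  _⊖_ : Carrier → Carrier → Carrier
  x ⊖ y = x +ꟳ (-ꟳ 1#) *ꟳ y

  x⊖y≈0⇒x≈y : ∀ {x y} → x ⊖ y ≈ 0# → x ≈ y
  x⊖y≈0⇒x≈y {x} {y} eq = x∙y⁻¹≈ε⇒x≈y x y (R.trans (R.+-congˡ (R.sym (-1*x≈-x y))) eq)

  x≈y⇒x⊖y≈0 : ∀ {x y} → x ≈ y → x ⊖ y ≈ 0#
  x≈y⇒x⊖y≈0 {x} {y} eq = R.trans (R.+-congˡ (-1*x≈-x y)) (x≈y⇒x∙y⁻¹≈ε eq)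

  sum-⊖ : ∀ {n} (x y a : Fin n → Carrier) →
          sumꟳ (λ j → (x j ⊖ y j) *ꟳ a j) ≈ sumꟳ (λ j → x j *ꟳ a j) ⊖ sumꟳ (λ j → y j *ꟳ a j)
  sum-⊖ x y a = begin
    sumꟳ (λ j → (x j ⊖ y j) *ꟳ a j)
      ≈⟨ sum-cong-≋ (λ j → R.trans (R.distribʳ (a j) (x j) _) (R.+-congˡ (R.*-assoc _ (y j) (a j)))) ⟩
    sumꟳ (λ j → (x j *ꟳ a j) ⊖ (y j *ꟳ a j))
      ≈⟨ ∑-distrib-+ (λ j → x j *ꟳ a j) (λ j → (-ꟳ 1#) *ꟳ (y j *ꟳ a j)) ⟩
    sumꟳ (λ j → x j *ꟳ a j) +ꟳ sumꟳ (λ j → (-ꟳ 1#) *ꟳ (y j *ꟳ a j))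
      ≈⟨ R.+-congˡ (*-distribˡ-sum (-ꟳ 1#) (λ j → y j *ꟳ a j)) ⟨
    sumꟳ (λ j → x j *ꟳ a j) ⊖ sumꟳ (λ j → y j *ꟳ a j) ∎

  sum-zero : ∀ {n} (f : Fin n → Carrier) → (∀ j → f j ≈ 0#) → sumꟳ f ≈ 0#
  sum-zero {n} f f≈0 = R.trans (sum-cong-≋ f≈0) (sum-replicate-zero n)

  sum-single : ∀ {n} (f : Fin n → Carrier) i → (∀ j → j ≢ i → f j ≈ 0#) → sumꟳ f ≈ f i
  sum-single f zero    f≈0 =
    R.trans (R.+-congˡ (sum-zero (f ∘ suc) (λ j → f≈0 (suc j) λ ()))) (R.+-identityʳ _)
  sum-single f (suc i) f≈0 =
    R.trans (R.+-cong (f≈0 zero λ ()) (sum-single (f ∘ suc) i λ j j≢i → f≈0 (suc j) (j≢i ∘ Fin.suc-injective)))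
      (R.+-identityˡ _)

  1<q : 1 < q
  1<q = distinct (F.0≉1 ∘ λ eq → R.trans (R.sym (I.inverseʳ refl)) (I.inverseʳ eq))
    where
    module I = Inverse hasSize
    distinct : ∀ {k} {i j : Fin k} → j ≢ i → 1 < k
    distinct {suc zero} {zero} {zero} j≢i = contradiction refl j≢i
    distinct {suc (suc _)} _ = s≤s (s≤s z≤n)

  instance
    q-nonZero : NonZero q
    q-nonZero = >-nonZero (ℕ.<-trans (s≤s z≤n) 1<q)

  -- Bounds on the rank.

  -- Extension by zero: it identifies vectors of length `∣ S ∣` with the coefficient vectors
  -- supported on `S` that `IndependentColumns` quantifies over.
  extend : ∀ {k} (S : Subset k) → (Fin ∣ S ∣ → Carrier) → Fin k → Carrier
  extend (true  ∷ S) v zero    = v zero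
  extend (true  ∷ S) v (suc j) = extend S (v ∘ suc) j
  extend (false ∷ S) v zero    = 0#
  extend (false ∷ S) v (suc j) = extend S v j

  extend-∉ : ∀ {k} (S : Subset k) v j → j ∉ S → extend S v j ≈ 0#
  extend-∉ (true  ∷ S) v zero    j∉S = contradiction here j∉S
  extend-∉ (true  ∷ S) v (suc j) j∉S = extend-∉ S (v ∘ suc) j (j∉S ∘ there)
  extend-∉ (false ∷ S) v zero    j∉S = R.refl
  extend-∉ (false ∷ S) v (suc j) j∉S = extend-∉ S v j (j∉S ∘ there)

  extend-injective : ∀ {k} (S : Subset k) v w → (∀ j → extend S v j ≈ extend S w j) → ∀ s → v s ≈ w s
  extend-injective (true  ∷ S) v w eq zero    = eq zero
  extend-injective (true  ∷ S) v w eq (suc s) = extend-injective S (v ∘ suc) (w ∘ suc) (eq ∘ suc) s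
  extend-injective (false ∷ S) v w eq s       = extend-injective S v w (eq ∘ suc) s

  -- An independent set of r columns embeds F^r into F^m.
  rank≤rows : ∀ {m k} (A : Matrix m k) → rank A ≤ m
  rank≤rows {m} A with rank-spec A
  ... | (S , ∣S∣≡r , ind) , _ = ≡.subst (_≤ m) ∣S∣≡r (ℕ.≮⇒≥ λ m<∣S∣ →
      ℕ.<⇒≱ (ℕ.^-monoʳ-< q 1<q m<∣S∣)
        (injection-size (pointwise-size hasSize ∣ S ∣) (pointwise-size hasSize m) combination combination-injective))
    where
    combination : (Fin ∣ S ∣ → Carrier) → Fin m → Carrier
    combination v i = sumꟳ (λ j → extend S v j *ꟳ A i j)
    combination-injective : ∀ v w → (∀ i → combination v i ≈ combination w i) → ∀ s → v s ≈ w s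
    combination-injective v w eq = extend-injective S v w λ j → x⊖y≈0⇒x≈y
      (ind (λ j → extend S v j ⊖ extend S w j)
        (λ j j∉S → x≈y⇒x⊖y≈0 (R.trans (extend-∉ S v j j∉S) (R.sym (extend-∉ S w j j∉S))))
        (λ i → R.trans (sum-⊖ (extend S v) (extend S w) (A i)) (x≈y⇒x⊖y≈0 (eq i)))
        j)

  -- An independent set contains no zero column, since the unit vector at that column would be a
  -- nontrivial relation. So all its members are below `w`.
  rank≤width : ∀ {m k} (A : Matrix m k) w → (∀ i j → w ≤ toℕ j → A i j ≈ 0#) → rank A ≤ w
  rank≤width {k = k} A w zeros with rank-spec A
  ... | (S , ∣S∣≡r , ind) , _ = ≡.subst (_≤ w) ∣S∣≡r (card S w λ j j∈S → ℕ.≰⇒> λ w≤j →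
      F.0≉1 (R.trans (R.sym (ind (unit j) (unit-∉ j∈S) (λ i → sum-zero _ (unit*A w≤j i)) j)) (unit-diagonal j)))
    where
    unit : Fin k → Fin k → Carrier
    unit j l with l Fin.≟ j
    ... | yes _ = 1#
    ... | no  _ = 0#
    unit-diagonal : ∀ j → unit j j ≈ 1#
    unit-diagonal j with j Fin.≟ j
    ... | yes _   = R.refl
    ... | no  j≢j = contradiction refl j≢j
    unit-∉ : ∀ {j} → j ∈ S → ∀ l → l ∉ S → unit j l ≈ 0#
    unit-∉ {j} j∈S l l∉S with l Fin.≟ j
    ... | yes refl = contradiction j∈S l∉S
    ... | no  _    = R.refl
    unit*A : ∀ {j} → w ≤ toℕ j → ∀ i l → unit j l *ꟳ A i l ≈ 0#
    unit*A {j} w≤j i l with l Fin.≟ j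
    ... | yes refl = R.trans (R.*-congˡ (zeros i j w≤j)) (R.zeroʳ 1#)
    ... | no  _    = R.zeroˡ _
    card : ∀ {k} (S : Subset k) w → (∀ j → j ∈ S → toℕ j < w) → ∣ S ∣ ≤ w
    card []          w       bound = z≤n
    card (true  ∷ S) zero    bound = contradiction (bound zero here) λ ()
    card (true  ∷ S) (suc w) bound = s≤s (card S w λ j j∈S → ℕ.≤-pred (bound (suc j) (there j∈S)))
    card (false ∷ S) zero    bound = card S zero λ j j∈S → contradiction (bound (suc j) (there j∈S)) λ ()
    card (false ∷ S) (suc w) bound = ℕ.m≤n⇒m≤1+n (card S w λ j j∈S → ℕ.≤-pred (bound (suc j) (there j∈S)))

  -- The column j alone is independent: row i of a relation reads x j · A i j = 0, and A i j is
  -- invertible.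
  entry≉0⇒0<rank : ∀ {m k} (A : Matrix m k) i j → ¬ A i j ≈ 0# → 0 < rank A
  entry≉0⇒0<rank A i j Aij≉0 = ≡.subst (_≤ rank A) (∣⁅x⁆∣≡1 j) (proj₂ (rank-spec A) ⁅ j ⁆ ind)
    where
    ind : IndependentColumns A ⁅ j ⁆
    ind x supp comb l with l Fin.≟ j
    ... | no  l≢j  = supp l (x≢y⇒x∉⁅y⁆ l≢j)
    ... | yes refl = let (y , ay≈1) = F.inverse (A i j) Aij≉0 in begin
      x j                     ≈⟨ R.*-identityʳ _ ⟨
      x j *ꟳ 1#               ≈⟨ R.*-congˡ ay≈1 ⟨
      x j *ꟳ (A i j *ꟳ y)     ≈⟨ R.*-assoc _ _ _ ⟨
      (x j *ꟳ A i j) *ꟳ y     ≈⟨ R.*-congʳ (sum-single (λ l → x l *ꟳ A i l) j λ l l≢j →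
                                   R.trans (R.*-congʳ (supp l (x≢y⇒x∉⁅y⁆ l≢j))) (R.zeroˡ _)) ⟨
      sumꟳ (λ l → x l *ꟳ A i l) *ꟳ y ≈⟨ R.*-congʳ (comb i) ⟩
      0# *ꟳ y                 ≈⟨ R.zeroˡ y ⟩
      0#                      ∎

  rank≡0⇒entry≈0 : ∀ {m k} (A : Matrix m k) → rank A ≡ 0 → ∀ i j → A i j ≈ 0#
  rank≡0⇒entry≈0 A r≡0 i j = decidable-stable (A i j ≈? 0#) λ Aij≉0 →
    ℕ.<-irrefl (≡.sym r≡0) (entry≉0⇒0<rank A i j Aij≉0)

  -- For i ≤ k ≤ j the entry (i, j) of `M` lies in the block `M [ k ]`, at row i and column j - k.
  block≡0⇒entry≈0 : ∀ {n} (M : Matrix n n) (k i j : Fin n) → toℕ i ≤ toℕ k → toℕ k ≤ toℕ j →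
                    rank (M [ k ]) ≡ 0 → M i j ≈ 0#
  block≡0⇒entry≈0 {n} M k i j i≤k k≤j r≡0 =
    ≡.subst₂ (λ i j → M i j ≈ 0#) row column (rank≡0⇒entry≈0 (M [ k ]) r≡0 r s)
    where
    r : Fin (suc (toℕ k))
    r = fromℕ< (s≤s i≤k)
    s : Fin (n ∸ toℕ k)
    s = fromℕ< (ℕ.∸-monoˡ-< (Fin.toℕ<n j) k≤j)
    row : inject≤ r (Fin.toℕ<n k) ≡ i
    row = toℕ-injective (≡.trans (Fin.toℕ-inject≤ r _) (Fin.toℕ-fromℕ< _))
    column : cast _ (toℕ k ↑ʳ s) ≡ j
    column = toℕ-injective (≡.trans (Fin.toℕ-cast _ (toℕ k ↑ʳ s)) (≡.trans (Fin.toℕ-↑ʳ (toℕ k) s)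
      (≡.trans (≡.cong (toℕ k +_) (Fin.toℕ-fromℕ< _)) (ℕ.m+[n∸m]≡n k≤j))))

  -- The size of the ball.

  -- A matrix in the ball is encoded by a t-tuple `e` that contains every index of a nonzero block,
  -- together with the entries at the sorted pairs from `e`. There are n^t tuples, and q^(t (t + 1)
  -- / 2) choices of entries. Repetitions in `e` only weaken the bound.
  ballSize-≤ : ∀ n t → Fin n → ballSize n t ≤ n ^ t * q ^ triangle t
  ballSize-≤ n t x₀ = injection-size (proj₂ (ball-finite n t))
    (×-size (pointwise-size (Identity.inverse (≡.setoid (Fin n))) t) (pointwise-size hasSize (triangle t)))
    encode encode-injective
    where
    cover : ∀ ((M , _) : ∃ (Ball n t)) →
            ∃ λ (e : Fin t → Fin n) → ∀ i → rank (M [ i ]) ≡ 0 ⊎ ∃[ s ] e s ≡ i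
    cover (M , _ , frM≤t) = cover-support x₀ t (λ i → i) (λ i → rank (M [ i ])) frM≤t
    position : (Fin t → Fin n) → Fin (triangle t) → Fin n × Fin n
    position e k = let (a , b) = upperPair t k in sort (e a) (e b)
    at : Matrix n n → Fin n × Fin n → Carrier
    at M (i , j) = M i j
    encode : ∃ (Ball n t) → (Fin t → Fin n) × (Fin (triangle t) → Carrier)
    encode B = let e = proj₁ (cover B) in e , λ k → at (proj₁ B) (position e k)
    encode-injective : ∀ B B′ →
      (∀ s → proj₁ (cover B) s ≡ proj₁ (cover B′) s) ×
      (∀ k → proj₂ (encode B) k ≈ proj₂ (encode B′) k) → proj₁ B ≈ᴹ proj₁ B′
    encode-injective B@(M , upM , _) B′@(M′ , upM′ , _) (e≗e′ , eq) i j with ℕ.<-≤-connex (toℕ j) (toℕ i)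
    ... | inj₁ j<i = R.trans (upM i j j<i) (R.sym (upM′ i j j<i))
    ... | inj₂ i≤j = go (found i) (found j)
      where
      e  = proj₁ (cover B)
      e′ = proj₁ (cover B′)
      -- The two codes share the tuple, so an index outside it belongs to a zero block of both
      -- matrices.
      found : ∀ l → (rank (M [ l ]) ≡ 0 × rank (M′ [ l ]) ≡ 0) ⊎ ∃[ s ] e s ≡ l
      found l with proj₂ (cover B) l | proj₂ (cover B′) l
      ... | inj₂ found  | _              = inj₂ found
      ... | inj₁ _      | inj₂ (s , e′s) = inj₂ (s , ≡.trans (e≗e′ s) e′s)
      ... | inj₁ r≡0    | inj₁ r′≡0      = inj₁ (r≡0 , r′≡0)
      -- The entry (i, j) lies in block i and in block j. If either index is outside the tuple, the
      -- entry is zero in both matrices; otherwise the encoding records it.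
      go : (rank (M [ i ]) ≡ 0 × rank (M′ [ i ]) ≡ 0) ⊎ (∃[ s ] e s ≡ i) →
           (rank (M [ j ]) ≡ 0 × rank (M′ [ j ]) ≡ 0) ⊎ (∃[ s ] e s ≡ j) → M i j ≈ M′ i j
      go (inj₁ (r≡0 , r′≡0)) _ = R.trans (block≡0⇒entry≈0 M i i j ℕ.≤-refl i≤j r≡0)
                                  (R.sym (block≡0⇒entry≈0 M′ i i j ℕ.≤-refl i≤j r′≡0))
      go (inj₂ _) (inj₁ (r≡0 , r′≡0)) = R.trans (block≡0⇒entry≈0 M j i j i≤j ℕ.≤-refl r≡0)
                                         (R.sym (block≡0⇒entry≈0 M′ j i j i≤j ℕ.≤-refl r′≡0))
      go (inj₂ (a , refl)) (inj₂ (b , refl)) with sort-surjective e a b i≤j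
      ... | k , pos = begin
        M (e a) (e b)        ≡⟨ ≡.cong (at M) pos ⟨
        at M (position e k)  ≈⟨ eq k ⟩
        at M′ (position e′ k) ≡⟨ ≡.cong (at M′) (≡.cong₂ sort (e≗e′ _) (e≗e′ _)) ⟨
        at M′ (position e k) ≡⟨ ≡.cong (at M′) pos ⟩
        M′ (e a) (e b)       ∎

  -- Matrices with prescribed support, and the anticode.

  -- For injective `pos` this parametrizes the matrices supported on the image of `pos`.
  scatter : ∀ {K n} → (Fin K → Fin n × Fin n) → (Fin K → Carrier) → Matrix n n
  scatter pos v i j with any? (λ k → Product.≡-dec Fin._≟_ Fin._≟_ (pos k) (i , j))
  ... | yes (k , _) = v k
  ... | no  _       = 0#

  scatter-pos : ∀ {K n} (pos : Fin K → Fin n × Fin n) v → (∀ k k′ → pos k ≡ pos k′ → k ≡ k′) →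
                ∀ k → scatter pos v (proj₁ (pos k)) (proj₂ (pos k)) ≈ v k
  scatter-pos pos v pos-inj k with any? (λ k′ → Product.≡-dec Fin._≟_ Fin._≟_ (pos k′) (pos k))
  ... | yes (k′ , eq) = R.reflexive (≡.cong v (pos-inj k′ k eq))
  ... | no  none      = contradiction (k , refl) none

  scatter-outside : ∀ {K n} (pos : Fin K → Fin n × Fin n) v i j → (∀ k → pos k ≢ (i , j)) →
                    scatter pos v i j ≈ 0#
  scatter-outside pos v i j none with any? (λ k → Product.≡-dec Fin._≟_ Fin._≟_ (pos k) (i , j))
  ... | yes (k , eq) = contradiction eq (none k)
  ... | no  _        = R.refl

  -- On or above the diagonal, j < t already places (i, j) in the leading t × t triangle, and the
  -- blocks `M [ i ]` see only such entries.
  AnticodeSupport : ∀ {n} → ℕ → Fin n → Fin n → Set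
  AnticodeSupport t i j = toℕ j < t ⊎ (toℕ i ≡ t × toℕ j ≡ t)

  -- With i counted from 0, `M [ i ]` has i + 1 rows. For i < t it misses row t, so only its first t
  -- - i columns can be nonzero; in `M [ t ]` only the entry (t, t) can survive; later blocks
  -- vanish. The rank is at most the smaller of the row and column bounds.
  anticode-fr : ∀ {n} t → t < n → 1 ≤ t → t ≤ 5 → (M : Matrix n n) →
                (∀ i j → ¬ AnticodeSupport t i j → M i j ≈ 0#) → fr M ≤ 2 * t
  anticode-fr {n} t t<n 1≤t t≤5 M supp =
    ℕ.≤-trans (sumℕ-mono-≤ λ i → ℕ.⊓-glb (rank≤rows (M [ i ])) (rank≤width (M [ i ]) _ (zeros i)))
      (weight (ℕ.m≤n⇒∃[o]m+o≡n t<n))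
    where
    weight : ∃[ m ] suc t + m ≡ n → sumℕ {n} (λ i → suc (toℕ i) ⊓ anticodeWidth t (toℕ i)) ≤ 2 * t
    weight (m , refl) = anticode-weight t m 1≤t t≤5
    zeros : ∀ i r s → anticodeWidth t (toℕ i) ≤ toℕ s → (M [ i ]) r s ≈ 0#
    zeros i r s w≤s = supp row column λ where
        (inj₁ j<t)           → ℕ.<⇒≱ (ℕ.m+n≤o⇒m≤o∸n (suc (toℕ s)) (≡.subst (_< t) column≡ j<t))
                                 (ℕ.≤-trans (ℕ.m≤m+n _ _) w≤s)
        (inj₂ (r≡t , j≡t)) → diagonal (≡.trans (≡.sym (Fin.toℕ-inject≤ r _)) r≡t) (≡.trans (≡.sym column≡) j≡t)
      where
      row = inject≤ r (Fin.toℕ<n i)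
      column = cast (ℕ.m+[n∸m]≡n (ℕ.<⇒≤ (Fin.toℕ<n i))) (toℕ i ↑ʳ s)
      column≡ : toℕ column ≡ toℕ s + toℕ i
      column≡ = ≡.trans (Fin.toℕ-cast _ (toℕ i ↑ʳ s)) (≡.trans (Fin.toℕ-↑ʳ (toℕ i) s) (ℕ.+-comm (toℕ i) (toℕ s)))
      -- Since r ≤ i ≤ j, the equalities r = t = j force i = t and s = 0, but the width at i = t is
      -- positive.
      diagonal : toℕ r ≡ t → toℕ s + toℕ i ≡ t → ⊥
      diagonal r≡t s+i≡t = ℕ.<⇒≱ (anticodeWidth-diagonal t)
        (≡.subst₂ _≤_ (≡.cong (anticodeWidth t) i≡t) s≡0 w≤s)
        where
        i≡t : toℕ i ≡ t
        i≡t = ℕ.≤-antisym (ℕ.≤-trans (ℕ.m≤n+m _ (toℕ s)) (ℕ.≤-reflexive s+i≡t))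
                (≡.subst (_≤ toℕ i) r≡t (ℕ.≤-pred (Fin.toℕ<n r)))
        s≡0 : toℕ s ≡ 0
        s≡0 = ℕ.+-cancelʳ-≡ (toℕ i) (toℕ s) 0 (≡.trans s+i≡t (≡.sym i≡t))

  anticodePosition : ∀ {n} t → t < n → Fin (suc (triangle t)) → Fin n × Fin n
  anticodePosition t t<n zero    = fromℕ< t<n , fromℕ< t<n
  anticodePosition t t<n (suc k) = let (i , j) = upperPair t k in
    inject≤ i (ℕ.<⇒≤ t<n) , inject≤ j (ℕ.<⇒≤ t<n)

  anticodePosition-support : ∀ {n} t (t<n : t < n) k →
    let (i , j) = anticodePosition t t<n k in AnticodeSupport t i j
  anticodePosition-support t t<n zero    = inj₂ (Fin.toℕ-fromℕ< t<n , Fin.toℕ-fromℕ< t<n)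
  anticodePosition-support t t<n (suc k) =
    inj₁ (≡.subst (_< t) (≡.sym (Fin.toℕ-inject≤ _ _)) (Fin.toℕ<n (proj₂ (upperPair t k))))

  anticodePosition-upper : ∀ {n} t (t<n : t < n) k →
    let (i , j) = anticodePosition t t<n k in toℕ i ≤ toℕ j
  anticodePosition-upper t t<n zero    = ℕ.≤-refl
  anticodePosition-upper t t<n (suc k) =
    ≡.subst₂ _≤_ (≡.sym (Fin.toℕ-inject≤ _ _)) (≡.sym (Fin.toℕ-inject≤ _ _)) (upperPair-≤ t k)

  -- The corner has row t, and all the other positions have a smaller row.
  anticodePosition-injective : ∀ {n} t (t<n : t < n) k k′ →
    anticodePosition t t<n k ≡ anticodePosition t t<n k′ → k ≡ k′
  anticodePosition-injective t t<n zero    zero     eq = refl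
  anticodePosition-injective t t<n zero    (suc k′) eq = contradiction
    (≡.trans (≡.sym (Fin.toℕ-inject≤ _ _)) (≡.trans (≡.cong (toℕ ∘ proj₁) (≡.sym eq)) (Fin.toℕ-fromℕ< t<n)))
    (ℕ.<⇒≢ (Fin.toℕ<n (proj₁ (upperPair t k′))))
  anticodePosition-injective t t<n (suc k) zero     eq = contradiction
    (≡.trans (≡.sym (Fin.toℕ-inject≤ _ _)) (≡.trans (≡.cong (toℕ ∘ proj₁) eq) (Fin.toℕ-fromℕ< t<n)))
    (ℕ.<⇒≢ (Fin.toℕ<n (proj₁ (upperPair t k))))
  anticodePosition-injective t t<n (suc k) (suc k′) eq = ≡.cong suc (upperPair-injective t k k′
    (≡.cong₂ _,_ (Fin.inject≤-injective _ _ _ _ (≡.cong proj₁ eq))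
                 (Fin.inject≤-injective _ _ _ _ (≡.cong proj₂ eq))))

  -- C meets the anticode trivially, so addition embeds their product into the
  -- upper triangular matrices.
  code-anticode-≤ : ∀ {p n t N} (C : LinearCode n p) → t < n → 1 ≤ t → t ≤ 5 →
                    HasMinimumDistance C (2 * t + 1) → HasSize (codeSetoid C) N →
                    N * q ^ suc (triangle t) ≤ q ^ triangle n
  code-anticode-≤ {n = n} {t} C t<n 1≤t t≤5 (_ , minimum) size = injection-size
    (×-size size (pointwise-size hasSize (suc (triangle t)))) (pointwise-size hasSize (triangle n))
    add add-injective
    where
    open LinearCode C
    pos = anticodePosition t t<n
    add : ∃ member × (Fin (suc (triangle t)) → Carrier) → Fin (triangle n) → Carrier
    add ((M , _) , v) k = let (i , j) = upperPair n k in M i j +ꟳ scatter pos v i j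

    scatter-unsupported : ∀ v i j → ¬ AnticodeSupport t i j → scatter pos v i j ≈ 0#
    scatter-unsupported v i j ¬supp = scatter-outside pos v i j λ k eq → ¬supp
      (≡.subst (λ (i , j) → AnticodeSupport t i j) eq (anticodePosition-support t t<n k))
    scatter-lower : ∀ v i j → toℕ j < toℕ i → scatter pos v i j ≈ 0#
    scatter-lower v i j j<i = scatter-outside pos v i j λ k eq → ℕ.<⇒≱ j<i
      (≡.subst (λ (i , j) → toℕ i ≤ toℕ j) eq (anticodePosition-upper t t<n k))

    add-injective : ∀ x y → (∀ k → add x k ≈ add y k) →
      (proj₁ (proj₁ x) ≈ᴹ proj₁ (proj₁ y)) × (∀ k → proj₂ x k ≈ proj₂ y k)
    add-injective ((M , M∈C) , v) ((M′ , M′∈C) , v′) eq = M≈M′ , v≈v′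
      where
      -- `add` records only entries on or above the diagonal; below it both summands are zero.
      sum≈ : ∀ i j → M i j +ꟳ scatter pos v i j ≈ M′ i j +ꟳ scatter pos v′ i j
      sum≈ i j with ℕ.<-≤-connex (toℕ j) (toℕ i)
      ... | inj₁ j<i = R.+-cong (R.trans (upper M∈C i j j<i) (R.sym (upper M′∈C i j j<i)))
                                (R.trans (scatter-lower v i j j<i) (R.sym (scatter-lower v′ i j j<i)))
      ... | inj₂ i≤j with upperPair-surjective n i j i≤j
      ...   | k , at-k = ≡.subst (λ (i , j) → M i j +ꟳ scatter pos v i j ≈ M′ i j +ꟳ scatter pos v′ i j) at-k (eq k)

      D : Matrix n n
      -- A difference of codewords which, by equality of the sums, is also a difference of anticode
      -- elements up to sign.
      D = M +ᴹ ((-ꟳ 1#) ∙ᴹ M′)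
      D-support : ∀ i j → ¬ AnticodeSupport t i j → D i j ≈ 0#
      D-support i j ¬supp = x≈y⇒x⊖y≈0 (begin
        M i j                         ≈⟨ R.+-identityʳ _ ⟨
        M i j +ꟳ 0#                   ≈⟨ R.+-congˡ (scatter-unsupported v i j ¬supp) ⟨
        M i j +ꟳ scatter pos v i j    ≈⟨ sum≈ i j ⟩
        M′ i j +ꟳ scatter pos v′ i j  ≈⟨ R.+-congˡ (scatter-unsupported v′ i j ¬supp) ⟩
        M′ i j +ꟳ 0#                  ≈⟨ R.+-identityʳ _ ⟩
        M′ i j                        ∎)
      D≈0 : ∀ i j → D i j ≈ 0#
      -- A nonzero entry would make `D` a nonzero codeword, of weight at least 2t + 1, whereas its
      -- support bounds the weight by 2t.
      D≈0 i j = decidable-stable (D i j ≈? 0#) λ Dij≉0 → ℕ.<⇒≱ (ℕ.m<m+n (2 * t) (s≤s z≤n))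
        (ℕ.≤-trans (minimum D (+-closed M∈C (∙-closed (-ꟳ 1#) M′∈C)) (λ D≈0 → Dij≉0 (D≈0 i j)))
          (anticode-fr t t<n 1≤t t≤5 D D-support))
      M≈M′ : M ≈ᴹ M′
      M≈M′ i j = x⊖y≈0⇒x≈y (D≈0 i j)
      v≈v′ : ∀ k → v k ≈ v′ k
      v≈v′ k = begin
        v k                ≈⟨ scatter-pos pos v (anticodePosition-injective t t<n) k ⟨
        scatter pos v i j  ≈⟨ +-cancelˡ (M i j) _ _ (R.trans (sum≈ i j) (R.+-congʳ (R.sym (M≈M′ i j)))) ⟩
        scatter pos v′ i j ≈⟨ scatter-pos pos v′ (anticodePosition-injective t t<n) k ⟩
        v′ k               ∎
        where
        i = proj₁ (pos k)
        j = proj₂ (pos k)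

  -- Comparison of the two bounds, and the theorem.

  -- With T = `triangle t` and b the size of the ball, N q^(T + 1) ≤ q^(n (n + 1) / 2) = N b ≤ N n^t
  -- q^T; cancel N and q^T.
  perfect⇒q≤n^t : ∀ {p n t} (C : LinearCode n p) → t < n → 1 ≤ t → t ≤ 5 →
                  IsPerfectWithMinimumDistance C (2 * t + 1) → q ≤ n ^ t
  perfect⇒q≤n^t {n = n} {t} C t<n 1≤t t≤5 (distance , N , size , perfect) =
    ℕ.*-cancelʳ-≤ q (n ^ t) (q ^ triangle t) {{ℕ.m^n≢0 q (triangle t)}}
      (ℕ.*-cancelˡ-≤ N {{N≢0}}
        (ℕ.≤-trans (code-anticode-≤ C t<n 1≤t t≤5 distance size)
          (ℕ.≤-trans (ℕ.≤-reflexive (≡.sym perfect′))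
            (ℕ.*-monoʳ-≤ N (ballSize-≤ n t (fromℕ< t<n))))))
    where
    radius : (2 * t + 1 ∸ 1) / 2 ≡ t
    radius = ≡.trans (≡.cong (_/ 2) (≡.trans (ℕ.m+n∸n≡m (2 * t) 1) (ℕ.*-comm 2 t))) (m*n/n≡m t 2)
    perfect′ : N * ballSize n t ≡ q ^ triangle n
    perfect′ = ≡.trans (≡.cong (λ r → N * ballSize n r) (≡.sym radius))
      (≡.trans perfect (≡.cong (q ^_) (n[n+1]/2≡triangle n)))
    -- N divides a power of q, which is nonzero.
    N≢0 : NonZero N
    N≢0 = ℕ.m*n≢0⇒m≢0 N {{≡.subst NonZero (≡.sym perfect′) (ℕ.m^n≢0 q (triangle n))}}

proposition5p16 : ∀ {c ℓ p : Level} (n t : ℕ) → 1 ≤ n → t < n →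
    let δ = 2 * t + 1 in
    (δ ∸ 1) + ⌊√ (δ ∸ 1) ⌋ * ⌊[√ (4 * (δ ∸ 1) + 1) -1]/2⌋ > t * (t + 1) / 2 →
    ∃[ q₀ ] (∀ (q : ℕ) → IsPrimePower q → q₀ ≤ q → (F : FiniteField c ℓ q) →
    let open FlagRank F in
    ¬ (∃[ C ] IsPerfectWithMinimumDistance {p = p} {n = n} C δ))
-- For t = 0 the condition reads 0 > 0.
proposition5p16 n zero    _ _   ()
-- The threshold n^t + 1 is the least one that excludes q ≤ n^t.
proposition5p16 n t@(suc _) _ t<n h = suc (n ^ t) , λ q _ n^t<q F (C , perfect) →
  ℕ.<⇒≱ n^t<q (perfect⇒q≤n^t F C t<n (s≤s z≤n) (condition⇒t≤5 t bound) perfect)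
  where
  bound : 2 * t + ⌊√ 2 * t ⌋ * ⌊[√ (4 * (2 * t) + 1) -1]/2⌋ > triangle t
  bound = ≡.subst₂ (λ r T → r + ⌊√ r ⌋ * ⌊[√ (4 * r + 1) -1]/2⌋ > T)
    (ℕ.m+n∸n≡m (2 * t) 1) (n[n+1]/2≡triangle t) h
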